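{- Let $A\subseteq\mathbb{R}^n$ and $B\subseteq\mathbb{R}^m$. Let $f:A\times B\to\mathbb{R}$ be continuous, with $f(a,\cdot)$ $\mu$-strongly concave for every $a\in A$ and $f$ $L$-Lipschitz on $A\times B$, and let $g:A\rightrightarrows B$ be an $L'$-Hausdorff Lipschitz continuous correspondence with non-empty, convex, compact values. Define $f^*(a)=\max_{b\in g(a)}f(a,b)$ and $g^*(a)=\arg\max_{b\in g(a)}f(a,b)$. Then $f^*$ is continuous and $g^*$ is an upper semi-continuous, non-empty, single-valued correspondence, i.e. a continuous function. Moreover $f^*$ is $(L+L L')$-Lipschitz continuous, and $g^*$ is $\big(L'+2\sqrt{4/\mu}\sqrt{L+LL'}\big)$-$(1/2)$-Hölder continuous for sufficiently small differences, i.e. $\|g^*(a_1)-g^*(a_2)\|\le\big(L'+2\sqrt{4/\mu}\sqrt{L+LL'}\big)\|a_1-a_2\|^{1/2}$ whenever $\|a_1-a_2\|$ is sufficiently small.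
   Context: $g$ is $L'$-Hausdorff Lipschitz if $d_H(g(a_1),g(a_2))\le L'\|a_1-a_2\|$, where $d_H$ is the Hausdorff distance. A correspondence $g^*$ is upper semi-continuous at $a_0$ if for every open $V\supseteq g^*(a_0)$ there is a neighborhood $U$ of $a_0$ with $g^*(a)\subseteq V$ for all $a\in U$. $f(a,\cdot)$ is $\mu$-strongly concave if $-f(a,\cdot)-\frac{\mu}{2}\|\cdot\|^2$ is convex... equivalently $f(a,\tfrac{x+y}{2})\ge\tfrac{f(a,x)+f(a,y)}{2}+\tfrac{\mu}{8}\|x-y\|^2$. -}

module Defs where

open import Level using (0ℓ; suc)
open import Data.Nat.Base using (ℕ)
open import Data.Product using (Σ; ∃; ∃-syntax; _×_; _,_; proj₁)
open import Data.Sum using (_⊎_; inj₁; inj₂)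
open import Data.List.Base using (List)
open import Data.List.Relation.Unary.Any using (Any)
open import Data.Vec.Base using (Vec; zipWith; map; foldr′; _++_)
open import Relation.Nullary using (¬_)
open import Relation.Unary using (Pred; _∈_; _⊆_; ⋃; Satisfiable)
open import Relation.Binary.Core using (Rel)
open import Relation.Binary.Bundles using (TotalOrder)
open import Relation.Binary.Structures using (IsTotalOrder)
open import Relation.Binary.PropositionalEquality using (_≡_; refl; cong; subst; subst₂; module ≡-Reasoning)
open import Algebra.Core using (Op₁; Op₂)
open import Algebra.Structures using (IsCommutativeRing)
import Algebra.Construct.NaturalChoice.Max as Max
import Algebra.Construct.NaturalChoice.MaxOp as MaxOp

module _ {X : Set} (_≤_ : Rel X 0ℓ) where

  IsUpperBound : Pred X 0ℓ → Pred X 0ℓ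
  IsUpperBound S u = ∀ {s} → s ∈ S → s ≤ u

  IsLowerBound : Pred X 0ℓ → Pred X 0ℓ
  IsLowerBound S l = ∀ {s} → s ∈ S → l ≤ s

  IsSup : Pred X 0ℓ → Pred X 0ℓ
  IsSup S u = IsUpperBound S u × (∀ {v} → IsUpperBound S v → u ≤ v)

  IsInf : Pred X 0ℓ → Pred X 0ℓ
  IsInf S l = IsLowerBound S l × (∀ {v} → IsLowerBound S v → v ≤ l)

  IsMax : Pred X 0ℓ → Pred X 0ℓ
  IsMax S u = u ∈ S × IsUpperBound S u

-- The standard library has no real numbers.  Classically the axioms below
-- (a Dedekind-complete totally ordered field) determine ℝ up to unique
-- isomorphism, so quantifying over this record is working over ℝ.
-- The value of 0# ⁻¹ is left unspecified.
record CompleteOrderedField : Set (suc 0ℓ) where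
  infix  4 _≤_ _<_
  infixl 6 _+_ _-_
  infixl 7 _*_ _/_
  infix  8 -_
  infix  9 _⁻¹
  field
    ℝ                 : Set
    _≤_               : Rel ℝ 0ℓ
    _+_ _*_           : Op₂ ℝ
    -_ _⁻¹            : Op₁ ℝ
    0# 1#             : ℝ
    isCommutativeRing : IsCommutativeRing _≡_ _+_ _*_ -_ 0# 1#
    1≢0               : ¬ 1# ≡ 0#
    ⁻¹-inverseʳ       : ∀ x → ¬ x ≡ 0# → x * x ⁻¹ ≡ 1#
    isTotalOrder      : IsTotalOrder _≡_ _≤_
    +-monoʳ-≤         : ∀ z {x y} → x ≤ y → z + x ≤ z + y
    *-nonneg          : ∀ {x y} → 0# ≤ x → 0# ≤ y → 0# ≤ x * y
    complete          : (S : Pred ℝ 0ℓ) → Satisfiable S →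
                        Satisfiable (IsUpperBound _≤_ S) → ∃ (IsSup _≤_ S)

  totalOrder : TotalOrder 0ℓ 0ℓ 0ℓ
  totalOrder = record { isTotalOrder = isTotalOrder }

  open Max totalOrder public using (_⊔_)

  _<_ : Rel ℝ 0ℓ
  x < y = x ≤ y × ¬ x ≡ y

  _-_ _/_ : Op₂ ℝ
  x - y = x + - y
  x / y = x * y ⁻¹

  2# 4# : ℝ
  2# = 1# + 1#
  4# = 2# + 2#

  ∣_∣ : Op₁ ℝ
  ∣ x ∣ = x ⊔ - x

module Analysis (F : CompleteOrderedField) where

  open CompleteOrderedField F public

  private
    open IsTotalOrder isTotalOrder using (total) renaming (trans to ≤-trans)
    open MaxOp (Max.maxOperator totalOrder) using (x≤x⊔y; x≤y⊔x)
    open IsCommutativeRing isCommutativeRing using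
      (+-assoc; +-identityˡ; +-identityʳ; -‿inverseˡ; -‿inverseʳ; *-identityʳ; distribˡ)

    y≤y*y : ∀ {y} → 0# ≤ y → 1# ≤ y → y ≤ y * y
    y≤y*y {y} 0≤y 1≤y = subst₂ _≤_ (+-identityʳ y) eq (+-monoʳ-≤ y (*-nonneg 0≤y 0≤d))
      where
      open ≡-Reasoning
      d : ℝ
      d = - 1# + y
      0≤d : 0# ≤ d
      0≤d = subst (_≤ d) (-‿inverseˡ 1#) (+-monoʳ-≤ (- 1#) 1≤y)
      eq : y + y * d ≡ y * y
      eq = begin
        y + y * d       ≡⟨ cong (_+ y * d) (*-identityʳ y) ⟨
        y * 1# + y * d  ≡⟨ distribˡ y 1# d ⟨
        y * (1# + d)    ≡⟨ cong (y *_) (+-assoc 1# (- 1#) y) ⟨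
        y * (1# + - 1# + y) ≡⟨ cong (λ z → y * (z + y)) (-‿inverseʳ 1#) ⟩
        y * (0# + y)    ≡⟨ cong (y *_) (+-identityˡ y) ⟩
        y * y           ∎

  SubRoot : ℝ → Pred ℝ 0ℓ
  SubRoot x y = y ≡ 0# ⊎ y * y ≤ x

  SubRoot-bounded : ∀ x → IsUpperBound _≤_ (SubRoot x) (0# ⊔ (1# ⊔ x))
  SubRoot-bounded x {y} y∈ with total y 0# | total y 1# | y∈
  ... | inj₁ y≤0 | _        | _          = ≤-trans y≤0 (x≤x⊔y 0# _)
  ... | inj₂ _   | inj₁ y≤1 | _          = ≤-trans y≤1 (≤-trans (x≤x⊔y 1# x) (x≤y⊔x 0# _))
  ... | inj₂ _   | inj₂ _   | inj₁ refl  = x≤x⊔y 0# _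
  ... | inj₂ 0≤y | inj₂ 1≤y | inj₂ y*y≤x =
    ≤-trans (y≤y*y 0≤y 1≤y) (≤-trans y*y≤x (≤-trans (x≤y⊔x 1# x) (x≤y⊔x 0# _)))

  -- The square root of x when 0# ≤ x, and 0# otherwise; the disjunct
  -- y ≡ 0# in SubRoot only serves to make the set inhabited for every x.
  √_ : Op₁ ℝ
  √ x = proj₁ (complete (SubRoot x) (0# , inj₁ refl) (_ , SubRoot-bounded x))

  _⊕_ _⊖_ : ∀ {k} → Op₂ (Vec ℝ k)
  _⊕_ = zipWith _+_
  _⊖_ = zipWith _-_

  _⊙_ : ∀ {k} → ℝ → Vec ℝ k → Vec ℝ k
  t ⊙ x = map (t *_) x

  ‖_‖ : ∀ {k} → Vec ℝ k → ℝ
  ‖ x ‖ = √ (foldr′ _+_ 0# (map (λ xᵢ → xᵢ * xᵢ) x))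

  distℝ : ℝ → ℝ → ℝ
  distℝ x y = ∣ x - y ∣

  dist : ∀ {k} → Vec ℝ k → Vec ℝ k → ℝ
  dist x y = ‖ x ⊖ y ‖

  -- The Euclidean distance of ℝⁿ × ℝᵐ = ℝⁿ⁺ᵐ.
  dist× : ∀ {n m} → Vec ℝ n × Vec ℝ m → Vec ℝ n × Vec ℝ m → ℝ
  dist× (a , b) (a′ , b′) = dist (a ++ b) (a′ ++ b′)

  module _ {X Y : Set} (dX : X → X → ℝ) (dY : Y → Y → ℝ) where

    ContinuousOn : Pred X 0ℓ → (X → Y) → Set
    ContinuousOn S h = ∀ {x} → x ∈ S → ∀ {ε} → 0# < ε → ∃[ δ ] 0# < δ ×
      (∀ {y} → y ∈ S → dX y x < δ → dY (h y) (h x) < ε)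

    LipschitzOn : ℝ → Pred X 0ℓ → (X → Y) → Set
    LipschitzOn K S h = ∀ {x y} → x ∈ S → y ∈ S → dY (h x) (h y) ≤ K * dX x y

  module _ {k : ℕ} where

    Open : Pred (Vec ℝ k) 0ℓ → Set
    Open U = ∀ {x} → x ∈ U → ∃[ ε ] 0# < ε × (∀ {y} → dist y x < ε → y ∈ U)

    Compact : Pred (Vec ℝ k) 0ℓ → Set₁
    Compact K = (I : Set) (U : I → Pred (Vec ℝ k) 0ℓ) → (∀ i → Open (U i)) →
      K ⊆ ⋃ I U → Σ (List I) λ is → ∀ {x} → x ∈ K → Any (λ i → x ∈ U i) is

    combination : ℝ → Vec ℝ k → Vec ℝ k → Vec ℝ k
    combination t x y = (t ⊙ x) ⊕ ((1# - t) ⊙ y)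

    Convex : Pred (Vec ℝ k) 0ℓ → Set
    Convex S = ∀ {x y t} → x ∈ S → y ∈ S → 0# ≤ t → t ≤ 1# → combination t x y ∈ S

    -- S is not assumed convex: the inequality is required exactly when all
    -- three points lie in the domain S of h.
    ConvexFunctionOn : Pred (Vec ℝ k) 0ℓ → (Vec ℝ k → ℝ) → Set
    ConvexFunctionOn S h = ∀ {x y t} → x ∈ S → y ∈ S → 0# ≤ t → t ≤ 1# →
      combination t x y ∈ S → h (combination t x y) ≤ t * h x + (1# - t) * h y

    StronglyConcaveOn : ℝ → Pred (Vec ℝ k) 0ℓ → (Vec ℝ k → ℝ) → Set
    StronglyConcaveOn μ S h =
      ConvexFunctionOn S (λ x → - h x - (μ / 2#) * (‖ x ‖ * ‖ x ‖))

    IsDistToSet : Vec ℝ k → Pred (Vec ℝ k) 0ℓ → Pred ℝ 0ℓ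
    IsDistToSet x Y = IsInf _≤_ (λ r → ∃[ y ] y ∈ Y × r ≡ dist x y)

    IsExcess : Pred (Vec ℝ k) 0ℓ → Pred (Vec ℝ k) 0ℓ → Pred ℝ 0ℓ
    IsExcess X Y = IsSup _≤_ (λ r → ∃[ x ] x ∈ X × IsDistToSet x Y r)

    -- The Hausdorff distance as a partial function: it need not exist for
    -- empty or unbounded sets.
    IsHausdorffDist : Pred (Vec ℝ k) 0ℓ → Pred (Vec ℝ k) 0ℓ → Pred ℝ 0ℓ
    IsHausdorffDist X Y r = ∃[ s ] ∃[ t ] IsExcess X Y s × IsExcess Y X t × r ≡ s ⊔ t

  Correspondence : ℕ → ℕ → Set₁
  Correspondence n m = Vec ℝ n → Pred (Vec ℝ m) 0ℓ

  module _ {n m : ℕ} where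

    HausdorffLipschitzOn : ℝ → Pred (Vec ℝ n) 0ℓ → Correspondence n m → Set
    HausdorffLipschitzOn K A g = ∀ {a₁ a₂} → a₁ ∈ A → a₂ ∈ A →
      ∃[ r ] IsHausdorffDist (g a₁) (g a₂) r × r ≤ K * dist a₁ a₂

    UpperSemicontinuousOn : Pred (Vec ℝ n) 0ℓ → Correspondence n m → Set₁
    UpperSemicontinuousOn A g = ∀ {a₀} → a₀ ∈ A →
      (V : Pred (Vec ℝ m) 0ℓ) → Open V → g a₀ ⊆ V →
      Σ (Pred (Vec ℝ n) 0ℓ) λ U → Open U × a₀ ∈ U × (∀ {a} → a ∈ A → a ∈ U → g a ⊆ V)

    module _ (f : Vec ℝ n × Vec ℝ m → ℝ) (g : Correspondence n m) where

      Values : Vec ℝ n → Pred ℝ 0ℓ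
      Values a v = ∃[ b ] b ∈ g a × v ≡ f (a , b)

      Argmax : Correspondence n m
      Argmax a b = b ∈ g a × IsUpperBound _≤_ (Values a) (f (a , b))

{-# OPTIONS --safe #-}

-- Let K = L + L L′.  A point b of g a₁ has a nearest point b′ in g a₂, at distance
-- at most L′ ‖a₁ - a₂‖, so f changes by at most K ‖a₁ - a₂‖ from (a₁ , b) to
-- (a₂ , b′); hence f* is K-Lipschitz.  Strong concavity gives quadratic growth at
-- the maximiser, ‖g*(a) - b‖² ≤ (4/μ) (f*(a) - f(a , b)) for b ∈ g a, which makes
-- it unique.  Applied at a₁ to the point of g a₁ nearest to g*(a₂), whose value is
-- at least f*(a₁) - 2K ‖a₁ - a₂‖, it yields the Hölder bound once ‖a₁ - a₂‖ ≤ 1,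
-- where ‖a₁ - a₂‖ ≤ ‖a₁ - a₂‖^½.

module Submission where

open import Defs
open import Level using (0ℓ)
open import Algebra.Bundles using (CommutativeRing)
import Algebra.Construct.NaturalChoice.Max as Max
import Algebra.Construct.NaturalChoice.MaxOp as MaxOp
open import Algebra.Structures using (IsCommutativeRing)
open import Axiom.ExcludedMiddle using (ExcludedMiddle)
open import Data.Empty using (⊥-elim)
open import Data.Integer.Base as ℤ using (ℤ; +_; -[1+_])
import Data.Integer.Properties as ℤ
import Data.List.Extrema as Extrema
import Data.List.Relation.Unary.All as All
import Data.List.Relation.Unary.Any as Any
open import Data.Maybe.Base using (Maybe; just; nothing)
open import Data.Nat.Base as ℕ using (ℕ; zero)
open import Data.Product using (Σ; ∃-syntax; _×_; _,_; proj₁; proj₂)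
open import Data.Sum using (_⊎_; inj₁; inj₂)
open import Data.Vec.Base using (Vec; []; _∷_; _++_; map; foldr′; replicate)
open import Relation.Binary.PropositionalEquality as ≡ using (_≡_; module ≡-Reasoning)
open import Relation.Binary.Structures using (IsTotalOrder)
open import Relation.Nullary using (¬_; yes; no; contradiction)
open import Relation.Unary using (Pred; _∈_; _⊆_; ⋃; _≐_; ｛_｝; _⟨×⟩_; Satisfiable)

-- The library's ring solver with coefficients in ℤ rather than in the ring
-- itself, whose equality cannot be decided by computation.

module IntegerCoefficients {c ℓ} (R : CommutativeRing c ℓ) where
  open CommutativeRing R hiding (zero)
  open import Algebra.Properties.Ring ring using (-‿distribˡ-*; -‿distribʳ-*; -0#≈0#; -‿involutive)
  open import Algebra.Properties.AbelianGroup +-abelianGroup using (⁻¹-∙-comm)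
  open import Algebra.Properties.Semiring.Mult.TCOptimised semiring renaming (_×_ to infixl 8 _·_)
  open import Algebra.Solver.Ring.AlmostCommutativeRing
  open import Relation.Binary.Reasoning.Setoid setoid

  fromℤ : ℤ → Carrier
  fromℤ (+ n)    = n · 1#
  fromℤ -[1+ n ] = - (ℕ.suc n · 1#)

  fromℤ-neg : ∀ i → fromℤ (ℤ.- i) ≈ - fromℤ i
  fromℤ-neg (+ zero)      = sym -0#≈0#
  fromℤ-neg (+ ℕ.suc n)   = refl
  fromℤ-neg -[1+ n ]      = sym (-‿involutive _)

  -- Sums of mixed sign reduce to this case. Dropping a successor from both arguments keeps the
  -- integer difference; in the ring, the matching move is to insert `1# - 1#`.
  fromℤ-⊖ : ∀ m n → fromℤ (m ℤ.⊖ n) ≈ m · 1# - n · 1#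
  fromℤ-⊖ zero      zero      = sym (-‿inverseʳ 0#)
  fromℤ-⊖ zero      (ℕ.suc n) = sym (+-identityˡ _)
  fromℤ-⊖ (ℕ.suc m) zero      = sym (trans (+-congˡ -0#≈0#) (+-identityʳ _))
  fromℤ-⊖ (ℕ.suc m) (ℕ.suc n) = begin
    fromℤ (ℕ.suc m ℤ.⊖ ℕ.suc n)           ≡⟨ ≡.cong fromℤ (ℤ.[1+m]⊖[1+n]≡m⊖n m n) ⟩
    fromℤ (m ℤ.⊖ n)                       ≈⟨ fromℤ-⊖ m n ⟩
    a - b                                 ≈⟨ +-congʳ (+-identityʳ a) ⟨
    a + 0# - b                            ≈⟨ +-congʳ (+-congˡ (-‿inverseʳ 1#)) ⟨
    a + (1# - 1#) - b                     ≈⟨ +-congʳ (+-assoc a 1# (- 1#)) ⟨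
    a + 1# - 1# - b                       ≈⟨ +-assoc (a + 1#) (- 1#) (- b) ⟩
    a + 1# + (- 1# - b)                   ≈⟨ +-cong (+-comm a 1#) (⁻¹-∙-comm 1# b) ⟩
    1# + a - (1# + b)                     ≈⟨ +-cong (1+× m 1#) (-‿cong (1+× n 1#)) ⟨
    ℕ.suc m · 1# - ℕ.suc n · 1#           ∎
    where
    a = m · 1#
    b = n · 1#

  fromℤ-+ : ∀ i j → fromℤ (i ℤ.+ j) ≈ fromℤ i + fromℤ j
  fromℤ-+ (+ m)    (+ n)    = ×-homo-+ 1# m n
  fromℤ-+ (+ m)    -[1+ n ] = fromℤ-⊖ m (ℕ.suc n)
  fromℤ-+ -[1+ m ] (+ n)    = trans (fromℤ-⊖ n (ℕ.suc m)) (+-comm _ _)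
  fromℤ-+ -[1+ m ] -[1+ n ] = begin
    fromℤ (-[1+ m ] ℤ.+ -[1+ n ])                   ≡⟨ ≡.cong fromℤ (ℤ.neg-distrib-+ (+ ℕ.suc m) (+ ℕ.suc n)) ⟨
    - fromℤ (+ (ℕ.suc m ℕ.+ ℕ.suc n))               ≈⟨ -‿cong (×-homo-+ 1# (ℕ.suc m) (ℕ.suc n)) ⟩
    - (ℕ.suc m · 1# + ℕ.suc n · 1#)                 ≈⟨ ⁻¹-∙-comm _ _ ⟨
    - (ℕ.suc m · 1#) - ℕ.suc n · 1#                 ∎

  fromℤ-pos-* : ∀ m j → fromℤ (+ m ℤ.* j) ≈ m · 1# * fromℤ j
  fromℤ-pos-* m (+ n)    = trans (reflexive (≡.cong fromℤ (≡.sym (ℤ.pos-* m n)))) (×1-homo-* m n)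
  fromℤ-pos-* m -[1+ n ] = begin
    fromℤ (+ m ℤ.* -[1+ n ])          ≡⟨ ≡.cong fromℤ (ℤ.neg-distribʳ-* (+ m) (+ ℕ.suc n)) ⟨
    fromℤ (ℤ.- (+ m ℤ.* + ℕ.suc n))   ≈⟨ fromℤ-neg (+ m ℤ.* + ℕ.suc n) ⟩
    - fromℤ (+ m ℤ.* + ℕ.suc n)       ≈⟨ -‿cong (fromℤ-pos-* m (+ ℕ.suc n)) ⟩
    - (m · 1# * (ℕ.suc n · 1#))       ≈⟨ -‿distribʳ-* _ _ ⟩
    m · 1# * - (ℕ.suc n · 1#)         ∎

  fromℤ-* : ∀ i j → fromℤ (i ℤ.* j) ≈ fromℤ i * fromℤ j
  fromℤ-* (+ m)    j = fromℤ-pos-* m j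
  fromℤ-* -[1+ m ] j = begin
    fromℤ (-[1+ m ] ℤ.* j)            ≡⟨ ≡.cong fromℤ (ℤ.neg-distribˡ-* (+ ℕ.suc m) j) ⟨
    fromℤ (ℤ.- (+ ℕ.suc m ℤ.* j))     ≈⟨ fromℤ-neg (+ ℕ.suc m ℤ.* j) ⟩
    - fromℤ (+ ℕ.suc m ℤ.* j)         ≈⟨ -‿cong (fromℤ-pos-* (ℕ.suc m) j) ⟩
    - (ℕ.suc m · 1# * fromℤ j)        ≈⟨ -‿distribˡ-* _ _ ⟩
    - (ℕ.suc m · 1#) * fromℤ j        ∎

  morphism : ℤ.+-*-rawRing -Raw-AlmostCommutative⟶ fromCommutativeRing R
  morphism = record
    { ⟦_⟧    = fromℤ
    ; +-homo = fromℤ-+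
    ; *-homo = fromℤ-*
    ; -‿homo = fromℤ-neg
    ; 0-homo = refl
    ; 1-homo = refl
    }

  -- Only soundness matters: distinct integers may have equal images in a general ring, so a failed
  -- comparison answers `nothing`.
  fromℤ-≟ : ∀ i j → Maybe (fromℤ i ≈ fromℤ j)
  fromℤ-≟ i j with i ℤ.≟ j
  ... | yes i≡j = just (reflexive (≡.cong fromℤ i≡j))
  ... | no  _   = nothing

  open import Algebra.Solver.Ring ℤ.+-*-rawRing (fromCommutativeRing R) morphism fromℤ-≟ public
    using (solve; _:=_; _:+_; _:*_; _:-_; :-_; con)

module Real (em : ExcludedMiddle 0ℓ) (F : CompleteOrderedField) where
  open Analysis F
  open ≡ using (refl; sym; trans; cong; cong₂; subst; subst₂)

  ring : CommutativeRing 0ℓ 0ℓ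
  ring = record { isCommutativeRing = isCommutativeRing }

  open IntegerCoefficients ring
  open IsTotalOrder isTotalOrder public using (total; antisym)
    renaming (refl to ≤-refl; reflexive to ≤-reflexive; trans to ≤-trans)
  open MaxOp (Max.maxOperator totalOrder) using (x≤x⊔y; ⊔-lub)
  open Extrema totalOrder using (argmax; f[xs]≤f[argmax])
  open IsCommutativeRing isCommutativeRing public
    using (+-identityˡ; +-identityʳ; *-identityˡ; *-identityʳ; zeroˡ; zeroʳ; -‿inverseʳ)

  -- Arithmetic and order in the field

  private variable
    a b c x y z : ℝ

  ≤⇒0≤- : x ≤ y → 0# ≤ y - x
  ≤⇒0≤- {x} {y} x≤y = subst₂ _≤_ (solve 1 (λ x → :- x :+ x := con (+ 0)) refl x)
                                 (solve 2 (λ x y → :- x :+ y := y :- x) refl x y)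
                                 (+-monoʳ-≤ (- x) x≤y)

  -- The pattern for most inequalities below: exhibit a visibly nonnegative `z` and leave
  -- `z ≡ y - x` to ring identities.
  ≤-fromDiff : 0# ≤ z → z ≡ y - x → x ≤ y
  ≤-fromDiff {z} {y} {x} 0≤z refl = subst (_≤ y) (+-identityʳ x)
    (subst (x + 0# ≤_) (solve 2 (λ x y → x :+ (y :- x) := y) refl x y) (+-monoʳ-≤ x 0≤z))

  +-nonneg : 0# ≤ x → 0# ≤ y → 0# ≤ x + y
  +-nonneg {x} {y} 0≤x 0≤y = ≤-trans 0≤x (subst (_≤ x + y) (+-identityʳ x) (+-monoʳ-≤ x 0≤y))

  +-mono-≤ : a ≤ b → x ≤ y → a + x ≤ b + y
  +-mono-≤ {a} {b} {x} {y} a≤b x≤y = ≤-fromDiff (+-nonneg (≤⇒0≤- a≤b) (≤⇒0≤- x≤y))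
    (solve 4 (λ a b x y → (b :- a) :+ (y :- x) := (b :+ y) :- (a :+ x)) refl a b x y)

  *-monoʳ-≤ : 0# ≤ z → x ≤ y → z * x ≤ z * y
  *-monoʳ-≤ {z} {x} {y} 0≤z x≤y = ≤-fromDiff (*-nonneg 0≤z (≤⇒0≤- x≤y))
    (solve 3 (λ x y z → z :* (y :- x) := z :* y :- z :* x) refl x y z)

  neg-antimono-≤ : x ≤ y → - y ≤ - x
  neg-antimono-≤ {x} {y} x≤y = ≤-fromDiff (≤⇒0≤- x≤y) (solve 2 (λ x y → y :- x := :- x :- (:- y)) refl x y)

  neg-cancel-≤ : - x ≤ - y → y ≤ x
  neg-cancel-≤ {x} {y} -x≤-y = ≤-fromDiff (≤⇒0≤- -x≤-y) (solve 2 (λ x y → :- y :- (:- x) := x :- y) refl x y)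

  *-self-nonneg : ∀ x → 0# ≤ x * x
  *-self-nonneg x with total 0# x
  ... | inj₁ 0≤x = *-nonneg 0≤x 0≤x
  ... | inj₂ x≤0 = subst (0# ≤_) (solve 1 (λ x → (con (+ 0) :- x) :* (con (+ 0) :- x) := x :* x) refl x)
                         (*-nonneg (≤⇒0≤- x≤0) (≤⇒0≤- x≤0))

  0≤1 : 0# ≤ 1#
  0≤1 = subst (0# ≤_) (*-identityˡ 1#) (*-self-nonneg 1#)

  0<1 : 0# < 1#
  0<1 = 0≤1 , λ 0≡1 → 1≢0 (sym 0≡1)

  ≤-<-trans : x ≤ y → y < z → x < z
  ≤-<-trans x≤y (y≤z , y≢z) = ≤-trans x≤y y≤z , λ { refl → y≢z (antisym y≤z x≤y) }

  <-≤-trans : x < y → y ≤ z → x < z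
  <-≤-trans (x≤y , x≢y) y≤z = ≤-trans x≤y y≤z , λ { refl → x≢y (antisym x≤y y≤z) }

  <⇒≱ : x < y → ¬ y ≤ x
  <⇒≱ (x≤y , x≢y) y≤x = x≢y (antisym x≤y y≤x)

  ≤⊎> : ∀ x y → x ≤ y ⊎ y < x
  ≤⊎> x y with total x y | em {y ≡ x}
  ... | inj₁ x≤y | _        = inj₁ x≤y
  ... | inj₂ _   | yes refl = inj₁ ≤-refl
  ... | inj₂ y≤x | no y≢x   = inj₂ (y≤x , y≢x)

  <-fromDiff : 0# < z → z ≡ y - x → x < y
  <-fromDiff (0≤z , 0≢z) z≡ = ≤-fromDiff 0≤z z≡ , λ { refl → 0≢z (sym (trans z≡ (-‿inverseʳ _))) }

  <⇒0<- : x < y → 0# < y - x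
  <⇒0<- {x} {y} (x≤y , x≢y) = ≤⇒0≤- x≤y , λ 0≡ → x≢y (trans (sym (+-identityˡ x))
    (trans (cong (_+ x) 0≡) (solve 2 (λ x y → y :- x :+ x := y) refl x y)))

  +-nonneg-pos : 0# ≤ x → 0# < y → 0# < x + y
  +-nonneg-pos {x} {y} 0≤x 0<y =
    <-≤-trans 0<y (≤-fromDiff 0≤x (solve 2 (λ x y → x := x :+ y :- y) refl x y))

  0<2 : 0# < 2#
  0<2 = +-nonneg-pos 0≤1 0<1

  0<4 : 0# < 4#
  0<4 = +-nonneg-pos (proj₁ 0<2) 0<2

  ⁻¹-inverse : 0# < x → x * x ⁻¹ ≡ 1#
  ⁻¹-inverse {x} (_ , 0≢x) = ⁻¹-inverseʳ x λ x≡0 → 0≢x (sym x≡0)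

  ⁻¹-nonneg : 0# < x → 0# ≤ x ⁻¹
  ⁻¹-nonneg {x} 0<x with total 0# (x ⁻¹)
  ... | inj₁ 0≤x⁻¹ = 0≤x⁻¹
  ... | inj₂ x⁻¹≤0 = contradiction 1≤0 (<⇒≱ 0<1)
    where
    1≤0 : 1# ≤ 0#
    1≤0 = ≤-fromDiff (*-nonneg (proj₁ 0<x) (≤⇒0≤- x⁻¹≤0))
      (trans (solve 2 (λ x w → x :* (con (+ 0) :- w) := con (+ 0) :- x :* w) refl x (x ⁻¹))
             (cong (λ o → 0# - o) (⁻¹-inverse 0<x)))

  *-cancelˡ-nonzero : ¬ x ≡ 0# → x * y ≡ 0# → y ≡ 0#
  *-cancelˡ-nonzero {x} {y} x≢0 xy≡0 = begin
    y               ≡⟨ *-identityˡ y ⟨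
    1# * y          ≡⟨ cong (_* y) (⁻¹-inverseʳ x x≢0) ⟨
    x * x ⁻¹ * y    ≡⟨ solve 3 (λ x w y → x :* w :* y := w :* (x :* y)) refl x (x ⁻¹) y ⟩
    x ⁻¹ * (x * y)  ≡⟨ cong (x ⁻¹ *_) xy≡0 ⟩
    x ⁻¹ * 0#       ≡⟨ zeroʳ _ ⟩
    0#              ∎
    where open ≡-Reasoning

  *-pos : 0# < x → 0# < y → 0# < x * y
  *-pos (0≤x , 0≢x) (0≤y , 0≢y) = *-nonneg 0≤x 0≤y ,
    λ 0≡xy → 0≢y (sym (*-cancelˡ-nonzero (λ x≡0 → 0≢x (sym x≡0)) (sym 0≡xy)))

  ⁻¹-pos : 0# < x → 0# < x ⁻¹
  ⁻¹-pos {x} 0<x = ⁻¹-nonneg 0<x ,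
    λ 0≡w → 1≢0 (trans (sym (⁻¹-inverse 0<x)) (trans (cong (x *_) (sym 0≡w)) (zeroʳ x)))

  *-self-zero : x * x ≡ 0# → x ≡ 0#
  *-self-zero {x} xx≡0 with em {x ≡ 0#}
  ... | yes x≡0 = x≡0
  ... | no  x≢0 = *-cancelˡ-nonzero x≢0 xx≡0

  -- If `y < x`, then with `d = x - y` the difference of squares is `2yd + d²`, which is positive.
  -- No sign of `x` is needed, so bounds between square roots can be checked on squares.
  *-self-cancel-≤ : 0# ≤ y → x * x ≤ y * y → x ≤ y
  *-self-cancel-≤ {y} {x} 0≤y xx≤yy with ≤⊎> x y
  ... | inj₁ x≤y = x≤y
  ... | inj₂ y<x = contradiction xx≤yy (<⇒≱ (<-fromDiff 0<d
          (solve 2 (λ x y → y :* (x :- y) :+ y :* (x :- y) :+ (x :- y) :* (x :- y) := x :* x :- y :* y) refl x y)))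
    where
    0≤yd : 0# ≤ y * (x - y)
    0≤yd = *-nonneg 0≤y (≤⇒0≤- (proj₁ y<x))
    0<d : 0# < y * (x - y) + y * (x - y) + (x - y) * (x - y)
    0<d = +-nonneg-pos (+-nonneg 0≤yd 0≤yd) (*-pos (<⇒0<- y<x) (<⇒0<- y<x))

  *-self-mono-≤ : 0# ≤ x → x ≤ y → x * x ≤ y * y
  *-self-mono-≤ {x} {y} 0≤x x≤y = ≤-fromDiff
    (+-nonneg (+-nonneg 0≤xd 0≤xd) (*-self-nonneg (y - x)))
    (solve 2 (λ x y → x :* (y :- x) :+ x :* (y :- x) :+ (y :- x) :* (y :- x) := y :* y :- x :* x) refl x y)
    where
    0≤xd : 0# ≤ x * (y - x)
    0≤xd = *-nonneg 0≤x (≤⇒0≤- x≤y)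

  -≤distℝ : ∀ x y → x - y ≤ distℝ x y
  -≤distℝ x y = x≤x⊔y _ _

  distℝ-lub : x - y ≤ c → y - x ≤ c → distℝ x y ≤ c
  distℝ-lub {x} {y} {c} p q = ⊔-lub p (subst (_≤ c) (solve 2 (λ x y → y :- x := :- (x :- y)) refl x y) q)

  -- Square roots

  √-isSup : ∀ x → IsSup _≤_ (SubRoot x) (√ x)
  √-isSup x = proj₂ (complete (SubRoot x) (0# , inj₁ refl) (_ , SubRoot-bounded x))

  √-nonneg : ∀ x → 0# ≤ √ x
  √-nonneg x = proj₁ (√-isSup x) (inj₁ refl)

  -- If `s * s` exceeded `x`, the Newton iterate `u` would lie strictly below `s`, while `u * u - x`
  -- is the square of the correction. So `u` would be an upper bound of `SubRoot x` smaller than the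
  -- least one.
  √-*-≤ : 0# ≤ x → √ x * √ x ≤ x
  √-*-≤ {x} 0≤x with ≤⊎> (√ x * √ x) x
  ... | inj₁ ss≤x = ss≤x
  ... | inj₂ x<ss = contradiction s≤u (<⇒≱ u<s)
    where
    s = √ x
    0<s : 0# < s
    0<s = √-nonneg x , λ 0≡s → <⇒≱ x<ss (subst (_≤ x) (trans (sym (zeroˡ 0#)) (cong₂ _*_ 0≡s 0≡s)) 0≤x)
    0<2s : 0# < s + s
    0<2s = +-nonneg-pos (√-nonneg x) 0<s
    w = (s + s) ⁻¹
    -- One step of Newton's iteration for √ x, started at s.
    u = s - (s * s - x) * w
    0<sub : 0# < (s * s - x) * w
    0<sub = *-pos (<⇒0<- x<ss) (⁻¹-pos 0<2s)
    u<s : u < s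
    u<s = <-fromDiff 0<sub (solve 2 (λ s e → e := s :- (s :- e)) refl s ((s * s - x) * w))
    uu : (s * s - x) * w * ((s * s - x) * w) ≡ u * u - x
    uu = begin
      e * e                                         ≡⟨ solve 2 (λ e D → e :* e := D :- D :* con (+ 1) :+ e :* e) refl e D ⟩
      D - D * 1# + e * e                            ≡⟨ cong (λ o → D - D * o + e * e) (⁻¹-inverse 0<2s) ⟨
      D - D * ((s + s) * w) + e * e                 ≡⟨ solve 3 (λ s w x →
         (s :* s :- x) :- (s :* s :- x) :* ((s :+ s) :* w) :+ (s :* s :- x) :* w :* ((s :* s :- x) :* w)
         := (s :- (s :* s :- x) :* w) :* (s :- (s :* s :- x) :* w) :- x) refl s w x ⟩
      u * u - x ∎
      where
      open ≡-Reasoning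
      D = s * s - x
      e = D * w
    x≤uu : x ≤ u * u
    x≤uu = ≤-fromDiff (*-self-nonneg ((s * s - x) * w)) uu
    -- Here `u` is rewritten as `(s² + x) / 2s`. Its sign settles the element `0#` of `SubRoot x`
    -- and permits comparing squares for the other elements.
    0≤u : 0# ≤ u
    0≤u = subst (0# ≤_) eq (*-nonneg (+-nonneg (*-self-nonneg s) 0≤x) (⁻¹-nonneg 0<2s))
      where
      open ≡-Reasoning
      eq : (s * s + x) * w ≡ u
      eq = begin
        (s * s + x) * w                           ≡⟨ solve 3 (λ s w x → (s :* s :+ x) :* w := s :* ((s :+ s) :* w) :- (s :* s :- x) :* w) refl s w x ⟩
        s * ((s + s) * w) - (s * s - x) * w       ≡⟨ cong (λ o → s * o - (s * s - x) * w) (⁻¹-inverse 0<2s) ⟩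
        s * 1# - (s * s - x) * w                  ≡⟨ cong (_- (s * s - x) * w) (*-identityʳ s) ⟩
        u ∎
    s≤u : s ≤ u
    s≤u = proj₂ (√-isSup x) λ { (inj₁ refl) → 0≤u
                              ; (inj₂ yy≤x) → *-self-cancel-≤ 0≤u (≤-trans yy≤x x≤uu) }

  -- If `s * s` fell short of `x` by `D`, the slightly larger `v = s + e` would still have its
  -- square at most `x`, hence belong to `SubRoot x` above its supremum.
  √-*-≥ : ∀ x → x ≤ √ x * √ x
  √-*-≥ x with ≤⊎> x (√ x * √ x)
  ... | inj₁ x≤ss = x≤ss
  ... | inj₂ ss<x = contradiction (proj₁ (√-isSup x) (inj₂ vv≤x)) (<⇒≱ s<v)
    where
    s = √ x
    D = x - s * s
    0<D : 0# < D
    0<D = <⇒0<- ss<x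
    -- With `e = D / (2s + D + 1)`, substituting `D = e (2s + D + 1)` into `x - v² = D - 2se - e²`
    -- leaves `eD + e(1 - e)`, and `e` is at most 1.
    0<T : 0# < (s + s + D) + 1#
    0<T = +-nonneg-pos (+-nonneg (+-nonneg (√-nonneg x) (√-nonneg x)) (proj₁ 0<D)) 0<1
    w = ((s + s + D) + 1#) ⁻¹
    e = D * w
    v = s + e
    0<e : 0# < e
    0<e = *-pos 0<D (⁻¹-pos 0<T)
    s<v : s < v
    s<v = <-fromDiff 0<e (solve 2 (λ s e → e := s :+ e :- s) refl s e)
    1-e : w * ((s + s) + 1#) ≡ 1# - e
    1-e = trans (solve 3 (λ s D w → w :* ((s :+ s) :+ con (+ 1)) := ((s :+ s :+ D) :+ con (+ 1)) :* w :- D :* w) refl s D w)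
                (cong (_- e) (⁻¹-inverse 0<T))
    0≤1-e : 0# ≤ 1# - e
    0≤1-e = subst (0# ≤_) 1-e (*-nonneg (⁻¹-nonneg 0<T) (+-nonneg (+-nonneg (√-nonneg x) (√-nonneg x)) 0≤1))
    vv≤x : v * v ≤ x
    vv≤x = ≤-fromDiff (+-nonneg (*-nonneg (proj₁ 0<e) (proj₁ 0<D)) (*-nonneg (proj₁ 0<e) 0≤1-e)) (begin
      e * D + e * (1# - e)                            ≡⟨ solve 3 (λ s D w →
         D :* w :* D :+ D :* w :* (con (+ 1) :- D :* w) := D :* (((s :+ s :+ D) :+ con (+ 1)) :* w) :- (s :+ s) :* (D :* w) :- D :* w :* (D :* w)) refl s D w ⟩
      D * (((s + s + D) + 1#) * w) - (s + s) * e - e * e  ≡⟨ cong (λ o → D * o - (s + s) * e - e * e) (⁻¹-inverse 0<T) ⟩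
      D * 1# - (s + s) * e - e * e                    ≡⟨ solve 3 (λ x s e →
         (x :- s :* s) :* con (+ 1) :- (s :+ s) :* e :- e :* e := x :- (s :+ e) :* (s :+ e)) refl x s e ⟩
      x - v * v ∎)
      where open ≡-Reasoning

  √-* : 0# ≤ x → √ x * √ x ≡ x
  √-* {x} 0≤x = antisym (√-*-≤ 0≤x) (√-*-≥ x)

  √0≡0 : √ 0# ≡ 0#
  √0≡0 = *-self-zero (√-* ≤-refl)

  -- Euclidean distance

  private variable
    k : ℕ

  sumSq : Vec ℝ k → ℝ
  sumSq x = foldr′ _+_ 0# (map (λ xᵢ → xᵢ * xᵢ) x)

  sumSq-nonneg : (x : Vec ℝ k) → 0# ≤ sumSq x
  sumSq-nonneg []       = ≤-refl
  sumSq-nonneg (x ∷ xs) = +-nonneg (*-self-nonneg x) (sumSq-nonneg xs)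

  ‖‖-* : (x : Vec ℝ k) → ‖ x ‖ * ‖ x ‖ ≡ sumSq x
  ‖‖-* x = √-* (sumSq-nonneg x)

  dist-nonneg : (x y : Vec ℝ k) → 0# ≤ dist x y
  dist-nonneg x y = √-nonneg _

  dist-refl : (x : Vec ℝ k) → dist x x ≡ 0#
  dist-refl x = trans (cong √_ (sumSq-⊖-self x)) √0≡0
    where
    sumSq-⊖-self : ∀ {k} (x : Vec ℝ k) → sumSq (x ⊖ x) ≡ 0#
    sumSq-⊖-self []       = refl
    sumSq-⊖-self (x ∷ xs) = trans (cong (λ s → (x - x) * (x - x) + s) (sumSq-⊖-self xs))
      (solve 1 (λ x → (x :- x) :* (x :- x) :+ con (+ 0) := con (+ 0)) refl x)

  dist-sym : (x y : Vec ℝ k) → dist x y ≡ dist y x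
  dist-sym x y = cong √_ (sumSq-⊖-swap x y)
    where
    sumSq-⊖-swap : ∀ {k} (x y : Vec ℝ k) → sumSq (x ⊖ y) ≡ sumSq (y ⊖ x)
    sumSq-⊖-swap []       []       = refl
    sumSq-⊖-swap (x ∷ xs) (y ∷ ys) = cong₂ _+_
      (solve 2 (λ x y → (x :- y) :* (x :- y) := (y :- x) :* (y :- x)) refl x y) (sumSq-⊖-swap xs ys)

  dist-zero : (x y : Vec ℝ k) → dist x y ≡ 0# → x ≡ y
  dist-zero x y d≡0 = sumSq-⊖-zero x y (≤-reflexive (begin
    sumSq (x ⊖ y)        ≡⟨ ‖‖-* (x ⊖ y) ⟨
    dist x y * dist x y  ≡⟨ cong (_* dist x y) d≡0 ⟩
    0# * dist x y        ≡⟨ zeroˡ _ ⟩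
    0#                   ∎))
    where
    open ≡-Reasoning
    sumSq-⊖-zero : ∀ {k} (x y : Vec ℝ k) → sumSq (x ⊖ y) ≤ 0# → x ≡ y
    sumSq-⊖-zero []       []       _    = refl
    sumSq-⊖-zero (x ∷ xs) (y ∷ ys) s≤0 = cong₂ _∷_ x≡y (sumSq-⊖-zero xs ys
        (≤-trans (≤-fromDiff (*-self-nonneg (x - y)) (solve 2 (λ p q → p := p :+ q :- q) refl p q)) s≤0))
      where
      p = (x - y) * (x - y)
      q = sumSq (xs ⊖ ys)
      p≤0 : p ≤ 0#
      p≤0 = ≤-trans (≤-fromDiff (sumSq-nonneg (xs ⊖ ys)) (solve 2 (λ p q → q := p :+ q :- p) refl p q)) s≤0
      x≡y : x ≡ y
      x≡y = begin
        x            ≡⟨ solve 2 (λ x y → x := x :- y :+ y) refl x y ⟩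
        x - y + y    ≡⟨ cong (_+ y) (*-self-zero (antisym p≤0 (*-self-nonneg (x - y)))) ⟩
        0# + y       ≡⟨ +-identityˡ y ⟩
        y            ∎

  -- Minkowski's inequality in the plane.
  hypot-+ : ∀ {u v p q r N M S} → 0# ≤ N → 0# ≤ M → 0# ≤ r → r ≤ p + q →
            N * N ≡ u * u + p * p → M * M ≡ v * v + q * q → S * S ≡ (u + v) * (u + v) + r * r →
            S ≤ N + M
  hypot-+ {u} {v} {p} {q} {r} {N} {M} {S} 0≤N 0≤M 0≤r r≤p+q NN MM SS =
    *-self-cancel-≤ (+-nonneg 0≤N 0≤M) (≤-trans (≤-reflexive SS) (≤-fromDiff
      (+-nonneg (≤⇒0≤- (*-self-mono-≤ 0≤r r≤p+q)) (+-nonneg (≤⇒0≤- cs) (≤⇒0≤- cs))) (begin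
        (p + q) * (p + q) - r * r + (N * M - (u * v + p * q) + (N * M - (u * v + p * q)))
          ≡⟨ solve 7 (λ u v p q r N M →
               (p :+ q) :* (p :+ q) :- r :* r :+ (N :* M :- (u :* v :+ p :* q) :+ (N :* M :- (u :* v :+ p :* q)))
               := (u :* u :+ p :* p) :+ (v :* v :+ q :* q) :+ (N :* M :+ N :* M) :- ((u :+ v) :* (u :+ v) :+ r :* r))
             refl u v p q r N M ⟩
        (u * u + p * p) + (v * v + q * q) + (N * M + N * M) - ((u + v) * (u + v) + r * r)
          ≡⟨ cong₂ (λ s t → s + t + (N * M + N * M) - ((u + v) * (u + v) + r * r)) NN MM ⟨
        N * N + M * M + (N * M + N * M) - ((u + v) * (u + v) + r * r)
          ≡⟨ solve 3 (λ N M s → N :* N :+ M :* M :+ (N :* M :+ N :* M) :- s := (N :+ M) :* (N :+ M) :- s)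
             refl N M ((u + v) * (u + v) + r * r) ⟩
        (N + M) * (N + M) - ((u + v) * (u + v) + r * r) ∎)))
    where
    open ≡-Reasoning
    -- Cauchy-Schwarz in the plane, from Lagrange's identity: the defect is the square of the
    -- determinant `u * q - p * v`.
    cs : u * v + p * q ≤ N * M
    cs = *-self-cancel-≤ (*-nonneg 0≤N 0≤M) (≤-fromDiff (*-self-nonneg (u * q - p * v)) (begin
      (u * q - p * v) * (u * q - p * v)
        ≡⟨ solve 4 (λ u v p q → (u :* q :- p :* v) :* (u :* q :- p :* v)
             := (u :* u :+ p :* p) :* (v :* v :+ q :* q) :- (u :* v :+ p :* q) :* (u :* v :+ p :* q)) refl u v p q ⟩
      (u * u + p * p) * (v * v + q * q) - (u * v + p * q) * (u * v + p * q)
        ≡⟨ cong₂ (λ s t → s * t - (u * v + p * q) * (u * v + p * q)) NN MM ⟨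
      N * N * (M * M) - (u * v + p * q) * (u * v + p * q)
        ≡⟨ solve 3 (λ N M s → N :* N :* (M :* M) :- s := N :* M :* (N :* M) :- s) refl N M _ ⟩
      N * M * (N * M) - (u * v + p * q) * (u * v + p * q) ∎))

  -- Induction on the dimension: each distance is the hypotenuse over the first-coordinate
  -- difference and the distance of the tails, so the planar inequality applies with the induction
  -- hypothesis as its premise `r ≤ p + q`.
  dist-triangle : (x y z : Vec ℝ k) → dist x z ≤ dist x y + dist y z
  dist-triangle []       []       []       = ≤-fromDiff (√-nonneg 0#) (solve 1 (λ s → s := s :+ s :- s) refl (√ 0#))
  dist-triangle (x ∷ xs) (y ∷ ys) (z ∷ zs) =
    hypot-+ (dist-nonneg (x ∷ xs) (y ∷ ys)) (dist-nonneg (y ∷ ys) (z ∷ zs))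
      (dist-nonneg xs zs) (dist-triangle xs ys zs)
      (dist-∷ x y xs ys) (dist-∷ y z ys zs)
      (trans (dist-∷ x z xs zs) (cong (λ s → s + dist xs zs * dist xs zs)
        (solve 3 (λ x y z → (x :- z) :* (x :- z) := ((x :- y) :+ (y :- z)) :* ((x :- y) :+ (y :- z))) refl x y z)))
    where
    dist-∷ : ∀ {k} x y (xs ys : Vec ℝ k) →
             dist (x ∷ xs) (y ∷ ys) * dist (x ∷ xs) (y ∷ ys) ≡ (x - y) * (x - y) + dist xs ys * dist xs ys
    dist-∷ x y xs ys = trans (‖‖-* ((x ∷ xs) ⊖ (y ∷ ys))) (cong (λ s → (x - y) * (x - y) + s) (sym (‖‖-* (xs ⊖ ys))))

  -- The left side squares to `p² + q²`, which is at most `(p + q)²`. This lets the two arguments of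
  -- `f` be moved separately.
  dist×-≤-+ : ∀ {n m} (a a′ : Vec ℝ n) (b b′ : Vec ℝ m) → dist× (a , b) (a′ , b′) ≤ dist a a′ + dist b b′
  dist×-≤-+ a a′ b b′ = *-self-cancel-≤ (+-nonneg (√-nonneg _) (√-nonneg _))
    (≤-fromDiff (+-nonneg 0≤pq 0≤pq) (begin
      p * q + p * q                                  ≡⟨ solve 2 (λ p q → p :* q :+ p :* q := (p :+ q) :* (p :+ q) :- (p :* p :+ q :* q)) refl p q ⟩
      (p + q) * (p + q) - (p * p + q * q)            ≡⟨ cong (λ s → (p + q) * (p + q) - s) dist×-* ⟨
      (p + q) * (p + q) - dist× (a , b) (a′ , b′) * dist× (a , b) (a′ , b′) ∎))
    where
    open ≡-Reasoning
    p = dist a a′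
    q = dist b b′
    0≤pq : 0# ≤ p * q
    0≤pq = *-nonneg (√-nonneg _) (√-nonneg _)
    sumSq-++ : ∀ {n} (a a′ : Vec ℝ n) → sumSq ((a ++ b) ⊖ (a′ ++ b′)) ≡ sumSq (a ⊖ a′) + sumSq (b ⊖ b′)
    sumSq-++ []      []        = sym (+-identityˡ _)
    sumSq-++ (x ∷ a) (x′ ∷ a′) = trans (cong (λ s → (x - x′) * (x - x′) + s) (sumSq-++ a a′))
      (solve 3 (λ s t r → s :+ (t :+ r) := s :+ t :+ r) refl ((x - x′) * (x - x′)) _ _)
    dist×-* : dist× (a , b) (a′ , b′) * dist× (a , b) (a′ , b′) ≡ p * p + q * q
    dist×-* = trans (‖‖-* ((a ++ b) ⊖ (a′ ++ b′)))
      (trans (sumSq-++ a a′) (sym (cong₂ _+_ (‖‖-* (a ⊖ a′)) (‖‖-* (b ⊖ b′)))))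

  -- The exact convexity gap of the squared norm, `t(1 - t)` times the squared distance. It follows
  -- coordinate by coordinate and is the source of the quadratic term in strong concavity.
  ‖combination‖-* : ∀ t (x y : Vec ℝ k) → ‖ combination t x y ‖ * ‖ combination t x y ‖ ≡
    t * (‖ x ‖ * ‖ x ‖) + (1# - t) * (‖ y ‖ * ‖ y ‖) - t * (1# - t) * (dist x y * dist x y)
  ‖combination‖-* t x y
    rewrite ‖‖-* (combination t x y) | ‖‖-* x | ‖‖-* y | ‖‖-* (x ⊖ y) = sumSq-combination x y
    where
    sumSq-combination : ∀ {k} (x y : Vec ℝ k) →
      sumSq (combination t x y) ≡ t * sumSq x + (1# - t) * sumSq y - t * (1# - t) * sumSq (x ⊖ y)
    sumSq-combination []       []       = solve 1 (λ t → con (+ 0) :=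
      t :* con (+ 0) :+ (con (+ 1) :- t) :* con (+ 0) :- t :* (con (+ 1) :- t) :* con (+ 0)) refl t
    sumSq-combination (x ∷ xs) (y ∷ ys) =
      trans (cong (λ s → (t * x + (1# - t) * y) * (t * x + (1# - t) * y) + s) (sumSq-combination xs ys))
        (solve 6 (λ t x y p q r →
          (t :* x :+ (con (+ 1) :- t) :* y) :* (t :* x :+ (con (+ 1) :- t) :* y)
            :+ (t :* p :+ (con (+ 1) :- t) :* q :- t :* (con (+ 1) :- t) :* r)
          := t :* (x :* x :+ p) :+ (con (+ 1) :- t) :* (y :* y :+ q)
            :- t :* (con (+ 1) :- t) :* ((x :- y) :* (x :- y) :+ r))
          refl t x y (sumSq xs) (sumSq ys) (sumSq (xs ⊖ ys)))

  -- Continuity and compactness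

  lipschitz⇒continuous : ∀ {X Y : Set} {dX : X → X → ℝ} {dY : Y → Y → ℝ} {S : Pred X 0ℓ} {h C} →
                         0# ≤ C → LipschitzOn dX dY C S h → ContinuousOn dX dY S h
  lipschitz⇒continuous {dX = dX} {C = C} 0≤C lip {x} x∈S {ε} 0<ε =
    -- The radius is `ε / (C + 1)`; adding 1 keeps the denominator positive when `C` is zero and
    -- makes `C` times the radius fall strictly below `ε`.
    ε * w , 0<εw , λ {y} y∈S d<εw →
      ≤-<-trans (lip y∈S x∈S) (≤-<-trans (*-monoʳ-≤ 0≤C (proj₁ d<εw)) (<-fromDiff 0<εw (begin
        ε * w                        ≡⟨ solve 3 (λ ε w C → ε :* w := ε :* ((C :+ con (+ 1)) :* w) :- C :* (ε :* w)) refl ε w C ⟩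
        ε * ((C + 1#) * w) - C * (ε * w)  ≡⟨ cong (λ o → ε * o - C * (ε * w)) (⁻¹-inverse 0<C+1) ⟩
        ε * 1# - C * (ε * w)         ≡⟨ cong (λ s → s - C * (ε * w)) (*-identityʳ ε) ⟩
        ε - C * (ε * w)              ∎)))
    where
    open ≡-Reasoning
    0<C+1 : 0# < C + 1#
    0<C+1 = +-nonneg-pos 0≤C 0<1
    w = (C + 1#) ⁻¹
    0<εw : 0# < ε * w
    0<εw = *-pos 0<ε (⁻¹-pos 0<C+1)

  hölder½⇒continuous : ∀ {n m} {S : Pred (Vec ℝ n) 0ℓ} {h : Vec ℝ n → Vec ℝ m} {C} → 0# ≤ C →
    (∀ {x y} → x ∈ S → y ∈ S → dist x y < 1# → dist (h x) (h y) ≤ C * √ (dist x y)) →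
    ContinuousOn dist dist S h
  hölder½⇒continuous {h = h} {C} 0≤C höl {x} x∈S {ε} 0<ε =
    -- The radius is squared so that the root of a distance below it is at most
    -- `w = ε / (ε + C + 1)`. The denominator gives both `w ≤ 1#`, which admits the local
    -- hypothesis, and `C * w < ε`.
    w * w , *-pos 0<w 0<w , λ {y} y∈S d<ww →
      ≤-<-trans (höl y∈S x∈S (<-≤-trans d<ww ww≤1))
        (≤-<-trans (*-monoʳ-≤ 0≤C (√d≤w y (proj₁ d<ww))) Cw<ε)
    where
    open ≡-Reasoning
    0<T : 0# < (ε + C) + 1#
    0<T = +-nonneg-pos (+-nonneg (proj₁ 0<ε) 0≤C) 0<1
    v = ((ε + C) + 1#) ⁻¹
    w = ε * v
    0<w : 0# < w
    0<w = *-pos 0<ε (⁻¹-pos 0<T)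
    w≤1 : w ≤ 1#
    w≤1 = ≤-fromDiff (*-nonneg (⁻¹-nonneg 0<T) (+-nonneg 0≤C 0≤1))
      (trans (solve 3 (λ ε v C → v :* (C :+ con (+ 1)) := ((ε :+ C) :+ con (+ 1)) :* v :- ε :* v) refl ε v C)
             (cong (_- w) (⁻¹-inverse 0<T)))
    ww≤1 : w * w ≤ 1#
    ww≤1 = subst (w * w ≤_) (*-identityˡ 1#) (*-self-mono-≤ (proj₁ 0<w) w≤1)
    √d≤w : ∀ y → dist y x ≤ w * w → √ (dist y x) ≤ w
    √d≤w y d≤ww = *-self-cancel-≤ (proj₁ 0<w) (≤-trans (≤-reflexive (√-* (dist-nonneg y x))) d≤ww)
    Cw<ε : C * w < ε
    Cw<ε = <-fromDiff (*-pos 0<w (+-nonneg-pos (proj₁ 0<ε) 0<1)) (begin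
      w * (ε + 1#)                         ≡⟨ solve 3 (λ ε v C →
        ε :* v :* (ε :+ con (+ 1)) := ε :* (((ε :+ C) :+ con (+ 1)) :* v) :- C :* (ε :* v)) refl ε v C ⟩
      ε * (((ε + C) + 1#) * v) - C * w     ≡⟨ cong (λ o → ε * o - C * w) (⁻¹-inverse 0<T) ⟩
      ε * 1# - C * w                       ≡⟨ cong (λ s → s - C * w) (*-identityʳ ε) ⟩
      ε - C * w                            ∎)

  ball-open : (x : Vec ℝ k) (δ : ℝ) → Open (λ y → dist y x < δ)
  ball-open x δ {y} yx<δ = δ - dist y x , <⇒0<- yx<δ , λ {z} zy<η →
    ≤-<-trans (dist-triangle z y x) (<-fromDiff (<⇒0<- zy<η)
      (solve 3 (λ δ p q → δ :- p :- q := δ :- (q :+ p)) refl δ (dist y x) (dist z y)))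

  -- If φ had no maximum, the sets "φ < φ y near x", y ∈ K, would cover K; the
  -- largest φ y of a finite subcover is then below another of these values.
  extreme-value : {K : Pred (Vec ℝ k) 0ℓ} {φ : Vec ℝ k → ℝ} → Satisfiable K → Compact K →
                  ContinuousOn dist distℝ K φ → ∃[ x ] x ∈ K × (∀ {y} → y ∈ K → φ y ≤ φ x)
  extreme-value {k} {K} {φ} (x₀ , x₀∈K) compact cont with em {∃[ x ] x ∈ K × (∀ {y} → y ∈ K → φ y ≤ φ x)}
  ... | yes max   = max
  ... | no  ¬max = contradiction (proj₁ i*≥) (<⇒≱ φi*<φi)
    where
    larger : ∀ {x} → x ∈ K → ∃[ y ] y ∈ K × φ x < φ y
    larger {x} x∈K with em {∃[ y ] y ∈ K × φ x < φ y}
    ... | yes ∃y = ∃y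
    ... | no ¬∃y = ⊥-elim (¬max (x , x∈K , bound))
      where
      bound : ∀ {y} → y ∈ K → φ y ≤ φ x
      bound {y} y∈K with ≤⊎> (φ y) (φ x)
      ... | inj₁ φy≤φx = φy≤φx
      ... | inj₂ φx<φy = contradiction (y , y∈K , φx<φy) ¬∃y

    I : Set
    I = Σ (Vec ℝ k) K

    -- Values are compared only at points of `K`, where continuity is known; the explicit radius
    -- still makes the set open in the whole space.
    U : I → Pred (Vec ℝ k) 0ℓ
    U (y , _) x = ∃[ δ ] 0# < δ × (∀ {z} → z ∈ K → dist z x < δ → φ z < φ y)

    U-open : ∀ i → Open (U i)
    U-open i {x} (δ , 0<δ , below) = δ , 0<δ , λ {y} y<δ →
      let η , 0<η , ball⊆ = ball-open x δ {y} y<δ in η , 0<η , λ {z} z∈K z<η → below z∈K (ball⊆ {z} z<η)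

    U-cover : K ⊆ ⋃ I U
    U-cover {x} x∈K =
      let y , y∈K , φx<φy = larger x∈K
          δ , 0<δ , close = cont x∈K (<⇒0<- φx<φy)
      in (y , y∈K) , δ , 0<δ , λ {z} z∈K z<δ →
           <-fromDiff (<⇒0<- (≤-<-trans (-≤distℝ (φ z) (φ x)) (close z∈K z<δ)))
             (solve 3 (λ x y z → y :- x :- (z :- x) := y :- z) refl (φ x) (φ y) (φ z))

    φ′ : I → ℝ
    φ′ (y , _) = φ y

    subcover = compact I U U-open U-cover

    i* : I
    i* = argmax φ′ (x₀ , x₀∈K) (proj₁ subcover)

    i*∈ = proj₂ subcover (proj₂ i*)

    i*≥ = All.lookupAny (f[xs]≤f[argmax] {f = φ′} (x₀ , x₀∈K) (proj₁ subcover)) i*∈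

    φi*<φi : φ′ i* < φ′ (Any.lookup i*∈)
    φi*<φi = let δ , 0<δ , below = proj₂ i*≥ in
      below (proj₂ i*) (subst (_< δ) (sym (dist-refl (proj₁ i*))) 0<δ)

  -- The extreme value theorem applies to minus the distance from `x`, which is 1-Lipschitz by the
  -- triangle inequality. The infimum is thus attained.
  nearest-point : {Y : Pred (Vec ℝ k) 0ℓ} → Satisfiable Y → Compact Y →
                  ∀ x → ∃[ y ] y ∈ Y × IsDistToSet x Y (dist x y)
  nearest-point {k} {Y} ∃y compact x =
    let y , y∈Y , nearest = extreme-value {K = Y} {φ = λ y → - dist x y} ∃y compact
                              (lipschitz⇒continuous {dX = dist} {dY = distℝ} {S = Y} 0≤1 λ {y} {z} _ _ → -dist-lipschitz y z)
    in y , y∈Y , (λ { (y′ , y′∈Y , refl) → neg-cancel-≤ (nearest y′∈Y) })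
               , (λ lower → lower (y , y∈Y , refl))
    where
    tri : ∀ y z → - dist x y - - dist x z ≤ 1# * dist y z
    tri y z = ≤-fromDiff (≤⇒0≤- (dist-triangle x y z))
      (solve 3 (λ p q r → p :+ r :- q := con (+ 1) :* r :- (:- p :- (:- q))) refl (dist x y) (dist x z) (dist y z))
    -dist-lipschitz : ∀ y z → distℝ (- dist x y) (- dist x z) ≤ 1# * dist y z
    -dist-lipschitz y z = distℝ-lub (tri y z)
      (subst (- dist x z - - dist x y ≤_) (cong (1# *_) (dist-sym z y)) (tri z y))

  -- Because the distance to `Y` is attained, the bound is `r` itself and not `r` plus an
  -- arbitrarily small error.
  hausdorff-partner : ∀ {X Y : Pred (Vec ℝ k) 0ℓ} {r} → Satisfiable Y → Compact Y → IsHausdorffDist X Y r →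
                      ∀ {x} → x ∈ X → ∃[ y ] y ∈ Y × dist x y ≤ r
  hausdorff-partner ∃y compact (s , t , (excess , _) , _ , refl) {x} x∈X =
    let y , y∈Y , isDist = nearest-point ∃y compact x
    in y , y∈Y , ≤-trans (excess (x , x∈X , isDist)) (x≤x⊔y s t)

  -- Selections and single-valued correspondences

  select : {X : Set} → X → Pred X 0ℓ → X
  select x P with em {Satisfiable P}
  ... | yes (y , _) = y
  ... | no  _       = x

  select-satisfies : {X : Set} (x : X) {P : Pred X 0ℓ} → Satisfiable P → select x P ∈ P
  select-satisfies x {P} ∃P with em {Satisfiable P}
  ... | yes (_ , Py) = Py
  ... | no  ¬∃P      = contradiction ∃P ¬∃P

  single-valued-usc : ∀ {n m} {A : Pred (Vec ℝ n) 0ℓ} {g : Correspondence n m} {h : Vec ℝ n → Vec ℝ m} →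
    (∀ {a} → a ∈ A → g a ≐ ｛ h a ｝) → ContinuousOn dist dist A h → UpperSemicontinuousOn A g
  single-valued-usc {A = A} {g} {h} g≐h cont {a₀} a₀∈A V V-open g⊆V =
    let ε , 0<ε , ball⊆V = V-open (g⊆V (proj₂ (g≐h a₀∈A) refl))
        δ , 0<δ , close  = cont a₀∈A 0<ε
    in (λ a → dist a a₀ < δ) , ball-open a₀ δ , subst (_< δ) (sym (dist-refl a₀)) 0<δ ,
       λ a∈A a∈U b∈ga → subst V (proj₁ (g≐h a∈A) b∈ga) (ball⊆V (close a∈A a∈U))

  -- Compare f at a maximiser b and at the midpoint of b and b′.
  quadratic-growth : ∀ {S G : Pred (Vec ℝ k) 0ℓ} {φ : Vec ℝ k → ℝ} {μ} → 0# < μ →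
    StronglyConcaveOn μ S φ → G ⊆ S → Convex G →
    ∀ {b b′} → b ∈ G → (∀ {x} → x ∈ G → φ x ≤ φ b) → b′ ∈ G →
    dist b b′ * dist b b′ ≤ (4# / μ) * (φ b - φ b′)
  quadratic-growth {G = G} {φ} {μ} 0<μ concave G⊆S convex {b} {b′} b∈G max b′∈G =
    -- `E` adds the slack in the optimality of `b` against `mid` to the slack in concavity at `mid`.
    -- The values at `mid` cancel, leaving half the gap of values minus `μ/8` times `D`; the factor
    -- `8/μ` normalises the coefficient of `D`.
    ≤-fromDiff (*-nonneg 0≤8w 0≤E) (begin
      (4# + 4#) * w * ((φ b - φ mid) + (k½ * (- φ b - M * B) + (1# - k½) * (- φ b′ - M * B′) - (- φ mid - M * N)))
        ≡⟨ cong (λ s → (4# + 4#) * w * ((φ b - φ mid) + (k½ * (- φ b - M * B) + (1# - k½) * (- φ b′ - M * B′) - (- φ mid - M * s))))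
             (‖combination‖-* k½ b b′) ⟩
      (4# + 4#) * w * ((φ b - φ mid) + (k½ * (- φ b - M * B) + (1# - k½) * (- φ b′ - M * B′)
        - (- φ mid - M * (k½ * B + (1# - k½) * B′ - k½ * (1# - k½) * D))))
        -- The inverses are atoms for the solver, so they are gathered into `2# * k½` and `μ * w`,
        -- which the next step replaces by 1.
        ≡⟨ solve 9 (λ k w μ x x′ y B B′ D → let one = con (+ 1); two = con (+ 2); four = two :+ two in
             (four :+ four) :* w :* ((x :- y) :+ (k :* (:- x :- μ :* k :* B) :+ (one :- k) :* (:- x′ :- μ :* k :* B′)
               :- (:- y :- μ :* k :* (k :* B :+ (one :- k) :* B′ :- k :* (one :- k) :* D))))
             := (four :+ four :- four :* (two :* k)) :* w :* (x :- x′)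
                :- (μ :* w) :* ((two :* k) :* (two :* k) :* (two :- two :* k)) :* D)
           refl k½ w μ (φ b) (φ b′) (φ mid) B B′ D ⟩
      (4# + 4# - 4# * (2# * k½)) * w * (φ b - φ b′) - (μ * w) * ((2# * k½) * (2# * k½) * (2# - 2# * k½)) * D
        ≡⟨ cong₂ (λ o o′ → (4# + 4# - 4# * o) * w * (φ b - φ b′) - o′ * (o * o * (2# - o)) * D)
             (⁻¹-inverse 0<2) (⁻¹-inverse 0<μ) ⟩
      (4# + 4# - 4# * 1#) * w * (φ b - φ b′) - 1# * (1# * 1# * (2# - 1#)) * D
        ≡⟨ solve 3 (λ w x D → let one = con (+ 1); two = con (+ 2); four = two :+ two in
             (four :+ four :- four :* one) :* w :* x :- one :* (one :* one :* (two :- one)) :* D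
             := four :* w :* x :- D) refl w (φ b - φ b′) D ⟩
      4# / μ * (φ b - φ b′) - D ∎)
    where
    open ≡-Reasoning
    k½ = 2# ⁻¹
    w = μ ⁻¹
    M = μ / 2#
    mid = combination k½ b b′
    B = ‖ b ‖ * ‖ b ‖
    B′ = ‖ b′ ‖ * ‖ b′ ‖
    N = ‖ mid ‖ * ‖ mid ‖
    D = dist b b′ * dist b b′
    0≤k½ : 0# ≤ k½
    0≤k½ = ⁻¹-nonneg 0<2
    k½≤1 : k½ ≤ 1#
    k½≤1 = ≤-fromDiff 0≤k½ (trans (solve 1 (λ k → k := con (+ 2) :* k :- k) refl k½)
                                  (cong (_- k½) (⁻¹-inverse 0<2)))
    mid∈G : mid ∈ G
    mid∈G = convex b∈G b′∈G 0≤k½ k½≤1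
    0≤8w : 0# ≤ (4# + 4#) * w
    0≤8w = *-nonneg (+-nonneg (proj₁ 0<4) (proj₁ 0<4)) (⁻¹-nonneg 0<μ)
    0≤E = +-nonneg (≤⇒0≤- (max mid∈G))
                   (≤⇒0≤- (concave (G⊆S b∈G) (G⊆S b′∈G) 0≤k½ k½≤1 (G⊆S mid∈G)))

  -- The parametric optimisation problem

  module Parametric {n m : ℕ} (A : Pred (Vec ℝ n) 0ℓ) (B : Pred (Vec ℝ m) 0ℓ)
    (f : Vec ℝ n × Vec ℝ m → ℝ) (g : Correspondence n m) (μ L L′ : ℝ)
    (0<μ : 0# < μ) (0≤L : 0# ≤ L) (0≤L′ : 0# ≤ L′)
    (f-concave : ∀ {a} → a ∈ A → StronglyConcaveOn μ B (λ b → f (a , b)))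
    (f-lipschitz : LipschitzOn dist× distℝ L (A ⟨×⟩ B) f)
    (g⊆B : ∀ {a} → a ∈ A → g a ⊆ B)
    (g-lipschitz : HausdorffLipschitzOn L′ A g)
    (g-values : ∀ {a} → a ∈ A → Satisfiable (g a) × Convex (g a) × Compact (g a)) where

    K : ℝ
    K = L + L * L′

    0≤K : 0# ≤ K
    0≤K = +-nonneg 0≤L (*-nonneg 0≤L 0≤L′)

    g* : Correspondence n m
    g* = Argmax f g

    f-distℝ-≤ : ∀ {a a′ b b′} → a ∈ A → a′ ∈ A → b ∈ g a → b′ ∈ g a′ →
                distℝ (f (a , b)) (f (a′ , b′)) ≤ L * (dist a a′ + dist b b′)
    f-distℝ-≤ {a} {a′} {b} {b′} a∈A a′∈A b∈ b′∈ =
      ≤-trans (f-lipschitz {a , b} {a′ , b′} (a∈A , g⊆B a∈A b∈) (a′∈A , g⊆B a′∈A b′∈))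
        (*-monoʳ-≤ 0≤L (dist×-≤-+ a a′ b b′))

    -- Moving the parameter by `d` and the point by at most `L′ * d` changes `f` by at most
    -- `L * (d + L′ * d)`, which is where `K` comes from. Both continuity bounds rest on this.
    partner : ∀ {a₁ a₂ b} → a₁ ∈ A → a₂ ∈ A → b ∈ g a₁ →
              ∃[ b′ ] b′ ∈ g a₂ × dist b b′ ≤ L′ * dist a₁ a₂ ×
                      f (a₁ , b) - f (a₂ , b′) ≤ K * dist a₁ a₂
    partner {a₁} {a₂} {b} a₁∈A a₂∈A b∈ =
      let r , isHausdorff , r≤ = g-lipschitz a₁∈A a₂∈A
          ∃b , _ , compact     = g-values a₂∈A
          b′ , b′∈ , d≤r       = hausdorff-partner {X = g a₁} {Y = g a₂} ∃b compact isHausdorff b∈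
          d≤                   = ≤-trans d≤r r≤
      in b′ , b′∈ , d≤ ,
         ≤-trans (-≤distℝ _ _) (≤-trans (f-distℝ-≤ a₁∈A a₂∈A b∈ b′∈)
           (≤-trans (*-monoʳ-≤ 0≤L (+-mono-≤ ≤-refl d≤))
             (≤-reflexive (solve 3 (λ L L′ d → L :* (d :+ L′ :* d) := (L :+ L :* L′) :* d) refl L L′ (dist a₁ a₂)))))

    -- At fixed `a` the parameter distance vanishes, so `f` is Lipschitz along the compact set `g a`
    -- and attains its maximum there.
    g*-nonempty : ∀ {a} → a ∈ A → Satisfiable (g* a)
    g*-nonempty {a} a∈A =
      let ∃b , _ , compact = g-values a∈A
          b , b∈ , max = extreme-value {K = g a} {φ = λ b → f (a , b)} ∃b compact
                           (lipschitz⇒continuous {dX = dist} {dY = distℝ} {S = g a} 0≤L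
                             λ {b} {b′} → slice b b′)
      in b , b∈ , λ { (b′ , b′∈ , refl) → max b′∈ }
      where
      slice : ∀ b b′ → b ∈ g a → b′ ∈ g a → distℝ (f (a , b)) (f (a , b′)) ≤ L * dist b b′
      slice b b′ b∈ b′∈ = subst (λ d → distℝ (f (a , b)) (f (a , b′)) ≤ L * d)
        (trans (cong (_+ dist b b′) (dist-refl a)) (+-identityˡ _)) (f-distℝ-≤ a∈A a∈A b∈ b′∈)

    growth : ∀ {a b b′} → a ∈ A → b ∈ g* a → b′ ∈ g a →
             dist b b′ * dist b b′ ≤ (4# / μ) * (f (a , b) - f (a , b′))
    growth {a} a∈A (b∈ , max) b′∈ =
      quadratic-growth {S = B} {G = g a} {φ = λ b → f (a , b)} 0<μ (f-concave a∈A) (g⊆B a∈A)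
        (proj₁ (proj₂ (g-values a∈A))) b∈ (λ {c} c∈ → max (c , c∈ , refl)) b′∈

    g*-unique : ∀ {a b b′} → a ∈ A → b ∈ g* a → b′ ∈ g* a → b ≡ b′
    g*-unique {a} {b} {b′} a∈A b∈g* b′∈g* = dist-zero b b′ (*-self-zero (antisym dd≤0 (*-self-nonneg _)))
      where
      f≡f : f (a , b) ≡ f (a , b′)
      f≡f = antisym (proj₂ b′∈g* (b , proj₁ b∈g* , refl)) (proj₂ b∈g* (b′ , proj₁ b′∈g* , refl))
      dd≤0 : dist b b′ * dist b b′ ≤ 0#
      dd≤0 = ≤-trans (growth a∈A b∈g* (proj₁ b′∈g*)) (≤-reflexive
        (trans (cong (λ v → (4# / μ) * (v - f (a , b′))) f≡f)
          (trans (cong ((4# / μ) *_) (-‿inverseʳ _)) (zeroʳ _))))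

    h : Vec ℝ n → Vec ℝ m
    -- The zero vector is a default for parameters without a maximiser; on `A` it is never taken.
    h a = select (replicate m 0#) (g* a)

    h∈g* : ∀ {a} → a ∈ A → h a ∈ g* a
    h∈g* {a} a∈A = select-satisfies (replicate m 0#) {P = g* a} (g*-nonempty a∈A)

    g*≐h : ∀ {a} → a ∈ A → g* a ≐ ｛ h a ｝
    g*≐h a∈A = (λ b∈ → g*-unique a∈A (h∈g* a∈A) b∈) , λ { refl → h∈g* a∈A }

    -- Lipschitz continuity of the maximum value

    f* : Vec ℝ n → ℝ
    f* a = f (a , h a)

    f*-isMax : ∀ {a} → a ∈ A → IsMax _≤_ (Values f g a) (f* a)
    f*-isMax {a} a∈A = (h a , proj₁ (h∈g* a∈A) , refl) , proj₂ (h∈g* a∈A)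

    -- The partner in `g a₂` of the maximiser at `a₁` has value at most `f* a₂`. Exchanging the
    -- parameters gives the other half of the Lipschitz bound.
    f*-gap : ∀ {a₁ a₂} → a₁ ∈ A → a₂ ∈ A → f* a₁ - f* a₂ ≤ K * dist a₁ a₂
    f*-gap {a₁} {a₂} a₁∈A a₂∈A =
      let b′ , b′∈ , _ , gap = partner a₁∈A a₂∈A (proj₁ (h∈g* a₁∈A))
      in ≤-trans (+-mono-≤ ≤-refl (neg-antimono-≤ (proj₂ (h∈g* a₂∈A) (b′ , b′∈ , refl)))) gap

    f*-lipschitz : LipschitzOn dist distℝ K A f*
    f*-lipschitz {a₁} {a₂} a₁∈A a₂∈A = distℝ-lub (f*-gap a₁∈A a₂∈A)
      (subst (λ d → f* a₂ - f* a₁ ≤ K * d) (dist-sym a₂ a₁) (f*-gap a₂∈A a₁∈A))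

    -- Hölder continuity of the maximiser

    C : ℝ
    C = L′ + 2# * √ (4# / μ) * √ K

    0≤C : 0# ≤ C
    0≤C = +-nonneg 0≤L′ (*-nonneg (*-nonneg (proj₁ 0<2) (√-nonneg _)) (√-nonneg _))

    0≤4/μ : 0# ≤ 4# / μ
    0≤4/μ = *-nonneg (proj₁ 0<4) (⁻¹-nonneg 0<μ)

    h-hölder : ∀ {a₁ a₂} → a₁ ∈ A → a₂ ∈ A → dist a₁ a₂ < 1# → dist (h a₁) (h a₂) ≤ C * √ (dist a₁ a₂)
    h-hölder {a₁} {a₂} a₁∈A a₂∈A d<1 =
      ≤-trans (dist-triangle (h a₁) p (h a₂))
        (≤-trans (+-mono-≤ near (≤-trans dist≤ (*-monoʳ-≤ 0≤L′ d≤e)))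
          (≤-reflexive (solve 4 (λ x r s e →
            con (+ 2) :* r :* s :* e :+ x :* e := (x :+ con (+ 2) :* r :* s) :* e) refl L′ r s e)))
      where
      d = dist a₁ a₂
      q = 4# / μ
      r = √ q
      s = √ K
      e = √ d
      -- The point of g a₁ nearest to the maximiser at a₂.
      p-partner = partner a₂∈A a₁∈A (proj₁ (h∈g* a₂∈A))
      p = proj₁ p-partner
      p∈ : p ∈ g a₁
      p∈ = proj₁ (proj₂ p-partner)
      dist≤ : dist p (h a₂) ≤ L′ * d
      dist≤ = subst₂ _≤_ (dist-sym (h a₂) p) (cong (L′ *_) (dist-sym a₂ a₁)) (proj₁ (proj₂ (proj₂ p-partner)))
      gap : f* a₂ - f (a₁ , p) ≤ K * d
      gap = subst (λ d → f* a₂ - f (a₁ , p) ≤ K * d) (dist-sym a₂ a₁) (proj₂ (proj₂ (proj₂ p-partner)))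
      0≤d : 0# ≤ d
      0≤d = dist-nonneg a₁ a₂
      -- One `K * d` is paid between the two maxima, another for moving the maximiser at `a₂` to
      -- `p`.
      loss : f* a₁ - f (a₁ , p) ≤ K * d + K * d
      loss = subst (_≤ K * d + K * d)
        (solve 3 (λ x y z → x :- y :+ (y :- z) := x :- z) refl (f* a₁) (f* a₂) (f (a₁ , p)))
        (+-mono-≤ (f*-gap a₁∈A a₂∈A) gap)
      square : 2# * r * s * e * (2# * r * s * e) ≡ 4# * (q * (K * d))
      square = begin
        2# * r * s * e * (2# * r * s * e)
          ≡⟨ solve 3 (λ r s e → con (+ 2) :* r :* s :* e :* (con (+ 2) :* r :* s :* e)
               := (con (+ 2) :+ con (+ 2)) :* ((r :* r) :* ((s :* s) :* (e :* e)))) refl r s e ⟩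
        4# * (r * r * (s * s * (e * e)))
          ≡⟨ cong₂ (λ x y → 4# * (x * y)) (√-* 0≤4/μ) (cong₂ _*_ (√-* 0≤K) (√-* 0≤d)) ⟩
        4# * (q * (K * d)) ∎
        where open ≡-Reasoning
      -- Growth and `loss` bound the square by `2q(K * d)`, while the right side squares to
      -- `4q(K * d)`; the constant 2 in the claim leaves this much room.
      near : dist (h a₁) p ≤ 2# * r * s * e
      near = *-self-cancel-≤
        (*-nonneg (*-nonneg (*-nonneg (proj₁ 0<2) (√-nonneg q)) (√-nonneg K)) (√-nonneg d))
        (≤-trans (≤-trans (growth a₁∈A (h∈g* a₁∈A) p∈) (*-monoʳ-≤ 0≤4/μ loss))
          (≤-fromDiff (*-nonneg (proj₁ 0<2) (*-nonneg 0≤4/μ (*-nonneg 0≤K 0≤d)))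
            (trans (solve 2 (λ q x → con (+ 2) :* (q :* x) := (con (+ 2) :+ con (+ 2)) :* (q :* x) :- q :* (x :+ x)) refl q (K * d))
                   (cong (_- q * (K * d + K * d)) (sym square)))))
      -- From `d < 1#` comes `d * d ≤ d = e * e`, so the linear term `L′ * d` is absorbed into
      -- `L′ * e`.
      d≤e : d ≤ e
      d≤e = *-self-cancel-≤ (√-nonneg d) (subst₂ _≤_ refl (trans (*-identityʳ d) (sym (√-* 0≤d)))
        (*-monoʳ-≤ 0≤d (proj₁ d<1)))

    h-continuous : ContinuousOn dist dist A h
    h-continuous = hölder½⇒continuous {S = A} {h = h} 0≤C h-hölder

mainTheorem16 : ExcludedMiddle 0ℓ → (F : CompleteOrderedField) → let open Analysis F in
    (n m : ℕ) (A : Pred (Vec ℝ n) 0ℓ) (B : Pred (Vec ℝ m) 0ℓ)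
    (f : Vec ℝ n × Vec ℝ m → ℝ) (g : Correspondence n m) (μ L L′ : ℝ) →
    0# < μ → 0# ≤ L → 0# ≤ L′ →
    ContinuousOn dist× distℝ (A ⟨×⟩ B) f →
    (∀ {a} → a ∈ A → StronglyConcaveOn μ B (λ b → f (a , b))) →
    LipschitzOn dist× distℝ L (A ⟨×⟩ B) f →
    (∀ {a} → a ∈ A → g a ⊆ B) →
    HausdorffLipschitzOn L′ A g →
    (∀ {a} → a ∈ A → Satisfiable (g a) × Convex (g a) × Compact (g a)) →
    let g* = Argmax f g in
    (∃[ f* ] (∀ {a} → a ∈ A → IsMax _≤_ (Values f g a) (f* a))
    × ContinuousOn dist distℝ A f*
    × LipschitzOn dist distℝ (L + L * L′) A f*)
    × UpperSemicontinuousOn A g*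
    × (∀ {a} → a ∈ A → Satisfiable (g* a))
    × (∀ {a b b′} → a ∈ A → b ∈ g* a → b′ ∈ g* a → b ≡ b′)
    × (∃[ h ] (∀ {a} → a ∈ A → g* a ≐ ｛ h a ｝)
    × ContinuousOn dist dist A h
    × (∃[ δ ] 0# < δ × (∀ {a₁ a₂} → a₁ ∈ A → a₂ ∈ A → dist a₁ a₂ < δ →
    dist (h a₁) (h a₂) ≤ (L′ + 2# * √ (4# / μ) * √ (L + L * L′)) * √ (dist a₁ a₂))))
mainTheorem16 em F n m A B f g μ L L′ 0<μ 0≤L 0≤L′ _ f-concave f-lipschitz g⊆B g-lipschitz g-values =
  (f* , f*-isMax , lipschitz⇒continuous {dX = dist} {dY = distℝ} {S = A} 0≤K f*-lipschitz , f*-lipschitz)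
  , single-valued-usc {A = A} {g = g*} {h = h} g*≐h h-continuous
  , g*-nonempty
  , g*-unique
  , h , g*≐h , h-continuous , 1# , 0<1 , h-hölder
  where
  open Analysis F
  open Real em F
  open Parametric A B f g μ L L′ 0<μ 0≤L 0≤L′ f-concave f-lipschitz g⊆B g-lipschitz g-values
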